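{- Let $q \ge 1$ be an integer. If $G$ is a $(q+1,6)$-Moore graph, then its packing chromatic number satisfies $$\chi_\rho(G) = q^2+q+2.$$
   Context: All graphs are finite, simple and undirected; $d(u,v)$ denotes the graph distance. A packing $k$-coloring of a graph $G$ is a function $\Gamma: V(G)\to\{1,2,\dots,k\}$ such that for every $i$, any two distinct vertices of color $i$ are at distance at least $i+1$. The packing chromatic number $\chi_\rho(G)$ is the smallest integer $k$ for which $G$ has a packing $k$-coloring. A $(k,g)$-graph is a $k$-regular graph of girth $g$. For $g$ even, a $(k,g)$-Moore graph is a $(k,g)$-graph with exactly $n_0(k,g)=2\sum_{i=0}^{g/2-1}(k-1)^i$ vertices (equal to $\frac{2(k-1)^{g/2}-2}{k-2}$ when $k\ge 3$), the minimum possible. In particular a $(q+1,6)$-Moore graph has $2(q^2+q+1)$ vertices; it is the point-line incidence graph of a symmetric generalized $3$-gon (projective plane) of order $q$. -}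

module Defs where

open import Level using (0ℓ)
open import Data.Fin using (Fin; zero; suc; inject₁; fromℕ)
open import Data.List using (length; filter; allFin; map; sum; upTo)
open import Data.Nat using (ℕ; zero; suc; _+_; _*_; _∸_; _^_; _/_; _≤_)
open import Data.Nat.Divisibility using (_∣_)
open import Data.Product using (_×_)
open import Function.Definitions using (Injective)
open import Relation.Binary using (Rel; Symmetric; Decidable)
open import Relation.Binary.PropositionalEquality using (_≡_; _≢_)
open import Relation.Nullary using (¬_)

-- Decidability of adjacency makes finite graphs constructively well behaved;
-- classically it is no restriction.
record Graph (n : ℕ) : Set₁ where
  field
    Adj    : Rel (Fin n) 0ℓ
    adj?   : Decidable Adj
    sym    : Symmetric Adj
    irrefl : ∀ v → ¬ Adj v v

module _ {n : ℕ} (G : Graph n) where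
  open Graph G

  data Walk : Fin n → Fin n → ℕ → Set where
    []  : ∀ {v} → Walk v v 0
    _∷_ : ∀ {u v w l} → Adj u v → Walk v w l → Walk u w (suc l)

  -- d(u,v) = d.  No d satisfies this when u and v lie in different components,
  -- that is, when d(u,v) = ∞.
  IsDistance : Fin n → Fin n → ℕ → Set
  IsDistance u v d = Walk u v d × (∀ l → Walk u v l → d ≤ l)

  -- d(u,v) ≥ m, with value ∞ allowed for d(u,v).
  DistanceAtLeast : Fin n → Fin n → ℕ → Set
  DistanceAtLeast u v m = ∀ d → IsDistance u v d → m ≤ d

  degree : Fin n → ℕ
  degree v = length (filter (adj? v) (allFin n))

  Regular : ℕ → Set
  Regular k = ∀ v → degree v ≡ k

  -- A cycle of length suc m, with vertices c 0, …, c m in cyclic order.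
  record IsCycle {m : ℕ} (c : Fin (suc m) → Fin n) : Set where
    field
      length≥3 : 3 ≤ suc m
      distinct : Injective _≡_ _≡_ c
      step     : ∀ (i : Fin m) → Adj (c (inject₁ i)) (c (suc i))
      close    : Adj (c (fromℕ m)) (c zero)

  data HasCycle : ℕ → Set where
    cycle : ∀ {m} (c : Fin (suc m) → Fin n) → IsCycle c → HasCycle (suc m)

  IsGirth : ℕ → Set
  IsGirth g = HasCycle g × (∀ m → HasCycle m → g ≤ m)

  record PackingColoring (k : ℕ) : Set where
    field
      Γ       : Fin n → ℕ
      Γ≥1     : ∀ v → 1 ≤ Γ v
      Γ≤k     : ∀ v → Γ v ≤ k
      packing : ∀ i u v → u ≢ v → Γ u ≡ i → Γ v ≡ i → DistanceAtLeast u v (i + 1)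

  -- χ_ρ(G) = χ.
  IsPackingChromaticNumber : ℕ → Set
  IsPackingChromaticNumber χ =
    PackingColoring χ × (∀ k → PackingColoring k → χ ≤ k)

-- n₀(k,g) = 2 · Σ_{i=0}^{g/2-1} (k-1)^i, meant for even g and k ≥ 1.
n₀ : ℕ → ℕ → ℕ
n₀ k g = 2 * sum (map (λ i → (k ∸ 1) ^ i) (upTo (g / 2)))

-- (k,g)-Moore graphs of even girth g only.
record IsMooreGraph {n : ℕ} (k g : ℕ) (G : Graph n) : Set where
  field
    even    : 2 ∣ g
    regular : Regular G k
    girth   : IsGirth G g
    order   : n ≡ n₀ k g

{-# OPTIONS --safe #-}

-- Write u ∼ v when u and v have a common neighbour, and N = q² + q + 1.  Without
-- 4-cycles, counting walks of length 2 shows that every class {v | x ∼ v} has N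
-- elements; without closed walks of length 5, the classes of the ends x, y of an
-- edge are disjoint.  As there are 2N vertices they are the two sides of a
-- bipartition (points and lines), and the diameter is at most 3.
--
-- Giving one side colour 1 and the vertices of the other side distinct further
-- colours uses N + 1 colours.  Conversely, every colour ≥ 3 occurs at most once
-- and colour 2 at most once on each side.  If colour 1 meets both sides then some
-- edge has no end of colour 1, so by double counting colour 1 occurs less than N
-- times.  Otherwise colour 1 stays on one side, whose other vertices may have
-- colour 2, and at most one vertex of the opposite side has colour 2.  Either way
-- colours 1 and 2 together cover at most N + 1 vertices.
module Submission where

open import Defs
open import Data.Bool using (true; false; if_then_else_)
open import Data.Empty using (⊥; ⊥-elim)
open import Data.Fin using (Fin; zero; suc; toℕ; fromℕ<)
open import Data.Fin.Properties using (any?; toℕ<n; toℕ-injective; toℕ-fromℕ<) renaming (_≟_ to _≟ᶠ_)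
import Data.Fin.Properties as Fin
open import Data.List using (List; length; filter; tabulate; allFin)
open import Data.List.Membership.Propositional using (_∈_)
open import Data.List.Membership.Propositional.Properties using (∈-filter⁺; ∈-allFin)
open import Data.List.Membership.Setoid.Properties using (index-injective)
open import Data.List.Relation.Unary.Any using (index)
open import Data.Nat using (ℕ; zero; suc; _+_; _*_; _∸_; _^_; _≤_; _<_; z≤n; s≤s; _≤?_; _≟_)
open import Data.Nat.Induction using (<-rec)
open import Data.Nat.Properties
open import Data.Nat.Tactic.RingSolver using (solve-∀)
open import Data.Product using (∃; _×_; _,_; proj₁; proj₂)
open import Data.Sum using (_⊎_; inj₁; inj₂)
open import Data.Vec using ([]; _∷_; lookup)
open import Data.Vec.Relation.Unary.All using ([]; _∷_)
open import Data.Vec.Relation.Unary.AllPairs using ([]; _∷_)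
open import Data.Vec.Relation.Unary.Unique.Propositional.Properties using (lookup-injective)
open import Function using (_∘_)
open import Level using (0ℓ)
open import Relation.Binary.PropositionalEquality
open import Relation.Nullary using (Dec; yes; no; does; ¬_; ¬?)
open import Relation.Nullary.Decidable using (_×-dec_; decidable-stable; dec-true; dec-false)
open import Relation.Unary using (Pred; Decidable)
open import Algebra.Properties.Semiring.Sum +-*-semiring
  using (sum; sum-syntax; sum-cong-≗; ∑-distrib-+; ∑-comm; *-distribˡ-sum; *-distribʳ-sum)

private variable
  n : ℕ
  A B : Set
  P : Pred (Fin n) 0ℓ

-- Counting by sums of indicators.

⟦_⟧ : Dec A → ℕ
⟦ d ⟧ = if does d then 1 else 0

⟦⟧-true : (d : Dec A) → A → ⟦ d ⟧ ≡ 1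
⟦⟧-true d a rewrite dec-true d a = refl

⟦⟧-false : (d : Dec A) → ¬ A → ⟦ d ⟧ ≡ 0
⟦⟧-false d ¬a rewrite dec-false d ¬a = refl

⟦⟧-× : (d : Dec A) (e : Dec B) → ⟦ d ×-dec e ⟧ ≡ ⟦ d ⟧ * ⟦ e ⟧
⟦⟧-× d e with does d
... | false = refl
... | true  = sym (*-identityˡ ⟦ e ⟧)

⟦⟧-cong : (A → B) → (B → A) → (d : Dec A) (e : Dec B) → ⟦ d ⟧ ≡ ⟦ e ⟧
⟦⟧-cong f g (yes a) e = sym (⟦⟧-true e (f a))
⟦⟧-cong f g (no ¬a) e = sym (⟦⟧-false e (¬a ∘ g))

⟦⟧-disjoint : (A → B → ⊥) → (d : Dec A) (e : Dec B) → ⟦ d ⟧ + ⟦ e ⟧ ≤ 1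
⟦⟧-disjoint ¬ab (yes a) e = ≤-reflexive (cong suc (⟦⟧-false e (¬ab a)))
⟦⟧-disjoint ¬ab (no _) (yes _) = ≤-refl
⟦⟧-disjoint ¬ab (no _) (no _)  = z≤n

sum-mono : {f g : Fin n → ℕ} → (∀ i → f i ≤ g i) → sum f ≤ sum g
sum-mono {zero}  f≤g = z≤n
sum-mono {suc n} f≤g = +-mono-≤ (f≤g zero) (sum-mono (f≤g ∘ suc))

sum-mono-< : {f g : Fin n → ℕ} → (∀ i → f i ≤ g i) → ∀ i → f i < g i → sum f < sum g
sum-mono-< f≤g zero    f<g = +-mono-<-≤ f<g (sum-mono (f≤g ∘ suc))
sum-mono-< f≤g (suc i) f<g = +-mono-≤-< (f≤g zero) (sum-mono-< (f≤g ∘ suc) i f<g)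

term≤sum : (f : Fin n → ℕ) → ∀ i → f i ≤ sum f
term≤sum f zero    = m≤m+n _ _
term≤sum f (suc i) = ≤-trans (term≤sum (f ∘ suc) i) (m≤n+m _ _)

sum-const : ∀ n c → ∑[ i < n ] c ≡ n * c
sum-const zero    c = refl
sum-const (suc n) c = cong (c +_) (sum-const n c)

count : Decidable P → ℕ
count P? = sum (λ i → ⟦ P? i ⟧)

count-empty : (P? : Decidable P) → (∀ i → ¬ P i) → count P? ≡ 0
count-empty {n} P? ¬P =
  trans (sum-cong-≗ (λ i → ⟦⟧-false (P? i) (¬P i))) (trans (sum-const n 0) (*-zeroʳ n))

-- Equality with the indicator of existence, rather than a bound by 1, is what turns the number of
-- common neighbours into the indicator of `∼`.
count-subsingleton : (P? : Decidable P) → (∀ i j → P i → P j → i ≡ j) →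
                     count P? ≡ ⟦ any? P? ⟧
count-subsingleton {zero}  P? P-prop = refl
count-subsingleton {suc n} P? P-prop with P? zero
... | yes p = cong suc (count-empty (P? ∘ suc) (λ i pi → Fin.0≢1+n (P-prop zero (suc i) p pi)))
... | no _  = count-subsingleton (P? ∘ suc) (λ _ _ pi pj → Fin.suc-injective (P-prop _ _ pi pj))

count-subsingleton-≤1 : (P? : Decidable P) → (∀ i j → P i → P j → i ≡ j) → count P? ≤ 1
count-subsingleton-≤1 P? P-prop rewrite count-subsingleton P? P-prop with does (any? P?)
... | true  = ≤-refl
... | false = z≤n

-- Links `degree` and the list `lines` to indicator sums; `f` is arbitrary so that the induction can
-- pass to `f ∘ suc`.
length-filter-tabulate : ∀ {m} (P? : Decidable P) (f : Fin m → Fin n) →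
                         length (filter P? (tabulate f)) ≡ count (P? ∘ f)
length-filter-tabulate {m = zero}  P? f = refl
length-filter-tabulate {m = suc m} P? f with does (P? (f zero))
... | true  = cong suc (length-filter-tabulate P? (f ∘ suc))
... | false = length-filter-tabulate P? (f ∘ suc)

-- `DistanceAtLeast` constrains only exact distances. By strong induction, a walk shorter than `m`
-- would have no shorter rival, so its length would be the distance.
walk-length-bound : (G : Graph n) → ∀ {u v m} → DistanceAtLeast G u v m →
                    ∀ l → Walk G u v l → m ≤ l
walk-length-bound G {u} {v} {m} far = <-rec _ bound
  where
  bound : ∀ l → (∀ {k} → k < l → Walk G u v k → m ≤ k) → Walk G u v l → m ≤ l
  bound l ih w with m ≤? l
  ... | yes m≤l = m≤l
  ... | no  m≰l = far l (w , λ k w′ → ≮⇒≥ λ k<l → m≰l (≤-trans (ih k<l w′) (<⇒≤ k<l)))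

-- Exclusion of short cycles.

module Girth≥6 {n : ℕ} (G : Graph n) (girth≥6 : ∀ m → HasCycle G m → 6 ≤ m) where
  open Graph G renaming (sym to adj-sym)

  adj⇒≢ : ∀ {u v} → Adj u v → u ≢ v
  adj⇒≢ {u} uv refl = irrefl u uv

  no-3-cycle : ∀ {a b c} → Adj a b → Adj b c → Adj c a → ⊥
  no-3-cycle {a} {b} {c} ab bc ca = <⇒≱ (m≤n+m 4 2) (girth≥6 3 (cycle (lookup xs) record
    { length≥3 = ≤-refl
    ; distinct = lookup-injective
        ((adj⇒≢ ab ∷ adj⇒≢ (adj-sym ca) ∷ []) ∷ (adj⇒≢ bc ∷ []) ∷ [] ∷ []) _ _
    ; step     = λ { zero → ab ; (suc zero) → bc }
    ; close    = ca
    }))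
    where xs = a ∷ b ∷ c ∷ []

  -- Used in this form: distinct vertices have at most one common neighbour.
  no-4-cycle : ∀ {a b c d} → Adj a b → Adj b c → Adj c d → Adj d a → a ≢ c → b ≡ d
  no-4-cycle {a} {b} {c} {d} ab bc cd da a≢c = decidable-stable (b ≟ᶠ d) λ b≢d →
    <⇒≱ (m≤n+m 5 1) (girth≥6 4 (cycle (lookup xs) record
    { length≥3 = m≤n+m 3 1
    ; distinct = lookup-injective
        ((adj⇒≢ ab ∷ a≢c ∷ adj⇒≢ (adj-sym da) ∷ []) ∷ (adj⇒≢ bc ∷ b≢d ∷ []) ∷
         (adj⇒≢ cd ∷ []) ∷ [] ∷ []) _ _
    ; step     = λ { zero → ab ; (suc zero) → bc ; (suc (suc zero)) → cd }
    ; close    = da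
    }))
    where xs = a ∷ b ∷ c ∷ d ∷ []

  -- No distinctness is assumed: adjacent vertices differ by irreflexivity, and identifying two
  -- others would leave a triangle.
  no-closed-5-walk : ∀ {a b c d e} → Adj a b → Adj b c → Adj c d → Adj d e → Adj e a → ⊥
  no-closed-5-walk {a} {b} {c} {d} {e} ab bc cd de ea =
    <⇒≱ ≤-refl (girth≥6 5 (cycle (lookup xs) record
    { length≥3 = m≤n+m 3 2
    ; distinct = lookup-injective
        ((adj⇒≢ ab ∷ a≢c ∷ a≢d ∷ adj⇒≢ (adj-sym ea) ∷ []) ∷ (adj⇒≢ bc ∷ b≢d ∷ b≢e ∷ []) ∷
         (adj⇒≢ cd ∷ c≢e ∷ []) ∷ (adj⇒≢ de ∷ []) ∷ [] ∷ []) _ _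
    ; step     = λ { zero → ab ; (suc zero) → bc ; (suc (suc zero)) → cd
                   ; (suc (suc (suc zero))) → de }
    ; close    = ea
    }))
    where
    xs = a ∷ b ∷ c ∷ d ∷ e ∷ []
    a≢c : a ≢ c
    a≢c refl = no-3-cycle cd de ea
    a≢d : a ≢ d
    a≢d refl = no-3-cycle ab bc cd
    b≢d : b ≢ d
    b≢d refl = no-3-cycle de ea ab
    b≢e : b ≢ e
    b≢e refl = no-3-cycle bc cd de
    c≢e : c ≢ e
    c≢e refl = no-3-cycle ea ab bc

-- The two sides of a Moore graph and its diameter.

module Moore {n : ℕ} (G : Graph n) (q : ℕ)
  (girth≥6 : ∀ m → HasCycle G m → 6 ≤ m)
  (regular : Regular G (suc q))
  (order : n ≡ 2 * suc (q + q * q)) where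

  open Graph G renaming (sym to adj-sym)
  open Girth≥6 G girth≥6

  N : ℕ
  N = suc (q + q * q)

  infix 4 _∼_ _∼?_

  _∼_ : Fin n → Fin n → Set
  u ∼ v = ∃ λ z → Adj u z × Adj z v

  _∼?_ : ∀ u v → Dec (u ∼ v)
  u ∼? v = any? (λ z → adj? u z ×-dec adj? z v)

  ∼-sym : ∀ {u v} → u ∼ v → v ∼ u
  ∼-sym (z , uz , zv) = z , adj-sym zv , adj-sym uz

  count-adj : ∀ u → count (adj? u) ≡ suc q
  count-adj u = trans (sym (length-filter-tabulate (adj? u) (λ v → v))) (regular u)

  count-adjʳ : ∀ v → count (λ u → adj? u v) ≡ suc q
  count-adjʳ v = trans (sum-cong-≗ (λ u → ⟦⟧-cong adj-sym adj-sym (adj? u v) (adj? v u))) (count-adj v)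

  neighbour : ∀ u → ∃ (Adj u)
  neighbour u = decidable-stable (any? (adj? u)) λ none →
    1+n≢0 (trans (sym (count-adj u)) (count-empty (adj? u) (λ v uv → none (v , uv))))

  ∼-refl : ∀ u → u ∼ u
  ∼-refl u = let z , uz = neighbour u in z , uz , adj-sym uz

  codegree : Fin n → Fin n → ℕ
  codegree u w = count (λ z → adj? u z ×-dec adj? z w)

  sum-codegree : ∀ u → ∑[ w < n ] codegree u w ≡ suc q * suc q
  sum-codegree u = begin
    ∑[ w < n ] ∑[ z < n ] ⟦ adj? u z ×-dec adj? z w ⟧
      ≡⟨ ∑-comm (λ w z → ⟦ adj? u z ×-dec adj? z w ⟧) ⟩
    ∑[ z < n ] ∑[ w < n ] ⟦ adj? u z ×-dec adj? z w ⟧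
      ≡⟨ sum-cong-≗ (λ z → sum-cong-≗ (λ w → ⟦⟧-× (adj? u z) (adj? z w))) ⟩
    ∑[ z < n ] ∑[ w < n ] (⟦ adj? u z ⟧ * ⟦ adj? z w ⟧)
      ≡⟨ sum-cong-≗ (λ z → *-distribˡ-sum ⟦ adj? u z ⟧ (λ w → ⟦ adj? z w ⟧)) ⟨
    ∑[ z < n ] (⟦ adj? u z ⟧ * count (adj? z))
      ≡⟨ sum-cong-≗ (λ z → cong (⟦ adj? u z ⟧ *_) (count-adj z)) ⟩
    ∑[ z < n ] (⟦ adj? u z ⟧ * suc q)
      ≡⟨ *-distribʳ-sum (suc q) (λ z → ⟦ adj? u z ⟧) ⟨
    count (adj? u) * suc q
      ≡⟨ cong (_* suc q) (count-adj u) ⟩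
    suc q * suc q ∎
    where open ≡-Reasoning

  -- Off the diagonal a common neighbour is unique; on it, the `suc q` neighbours exceed the
  -- indicator of `u ∼ u` by `q`.
  codegree-∼ : ∀ u w → codegree u w ≡ ⟦ u ∼? w ⟧ + ⟦ u ≟ᶠ w ⟧ * q
  codegree-∼ u w with u ≟ᶠ w
  ... | no u≢w = trans
    (count-subsingleton (λ z → adj? u z ×-dec adj? z w)
      (λ { _ _ (uz , zw) (uz′ , z′w) → no-4-cycle uz zw (adj-sym z′w) (adj-sym uz′) u≢w }))
    (sym (+-identityʳ _))
  ... | yes refl = begin
    codegree u u
      ≡⟨ sum-cong-≗ (λ z → ⟦⟧-cong proj₁ (λ uz → uz , adj-sym uz) (adj? u z ×-dec adj? z u) (adj? u z)) ⟩
    count (adj? u)      ≡⟨ count-adj u ⟩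
    1 + q               ≡⟨ cong₂ _+_ (⟦⟧-true (u ∼? u) (∼-refl u)) (*-identityˡ q) ⟨
    ⟦ u ∼? u ⟧ + 1 * q  ∎
    where open ≡-Reasoning

  count-≟ : ∀ (u : Fin n) → count (u ≟ᶠ_) ≡ 1
  count-≟ u = trans (count-subsingleton (u ≟ᶠ_) (λ { _ _ refl refl → refl }))
                    (⟦⟧-true (any? (u ≟ᶠ_)) (u , refl))

  -- Of the `suc q * suc q` walks of length 2 from `u`, `suc q` return to `u` and the others end at
  -- distinct vertices. So their number `N + q` overcounts the class, which contains `u`, by `q`.
  count-∼ : ∀ u → count (u ∼?_) ≡ N
  count-∼ u = +-cancelʳ-≡ q _ _ (begin
    count (u ∼?_) + q
      ≡⟨ cong (count (u ∼?_) +_) (trans (cong (_* q) (count-≟ u)) (*-identityˡ q)) ⟨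
    count (u ∼?_) + count (u ≟ᶠ_) * q
      ≡⟨ cong (count (u ∼?_) +_) (*-distribʳ-sum q (λ w → ⟦ u ≟ᶠ w ⟧)) ⟩
    count (u ∼?_) + ∑[ w < n ] (⟦ u ≟ᶠ w ⟧ * q)
      ≡⟨ ∑-distrib-+ (λ w → ⟦ u ∼? w ⟧) (λ w → ⟦ u ≟ᶠ w ⟧ * q) ⟨
    ∑[ w < n ] (⟦ u ∼? w ⟧ + ⟦ u ≟ᶠ w ⟧ * q)
      ≡⟨ sum-cong-≗ (codegree-∼ u) ⟨
    ∑[ w < n ] codegree u w
      ≡⟨ sum-codegree u ⟩
    suc q * suc q
      ≡⟨ square q ⟩
    N + q ∎)
    where
    open ≡-Reasoning
    square : ∀ m → suc m * suc m ≡ suc (m + m * m) + m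
    square = solve-∀

  sides-disjoint : ∀ {x y w} → Adj x y → x ∼ w → y ∼ w → ⊥
  sides-disjoint xy (a , xa , aw) (b , yb , bw) =
    no-closed-5-walk xa aw (adj-sym bw) (adj-sym yb) (adj-sym xy)

  -- The classes being disjoint, their indicators add up to at most 1 at every vertex. A missed `w`
  -- would push the total strictly below `n`, yet it is `N + N`.
  sides-cover : ∀ {x y} → Adj x y → ∀ w → x ∼ w ⊎ y ∼ w
  sides-cover {x} {y} xy w with x ∼? w | y ∼? w
  ... | yes xw | _      = inj₁ xw
  ... | no _   | yes yw = inj₂ yw
  ... | no ¬xw | no ¬yw = ⊥-elim (<-irrefl total
          (sum-mono-< (λ v → ⟦⟧-disjoint (sides-disjoint xy) (x ∼? v) (y ∼? v)) w
            (s≤s (≤-reflexive (cong₂ _+_ (⟦⟧-false (x ∼? w) ¬xw) (⟦⟧-false (y ∼? w) ¬yw))))))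
    where
    open ≡-Reasoning
    total : ∑[ v < n ] (⟦ x ∼? v ⟧ + ⟦ y ∼? v ⟧) ≡ ∑[ v < n ] 1
    total = begin
      ∑[ v < n ] (⟦ x ∼? v ⟧ + ⟦ y ∼? v ⟧)
        ≡⟨ ∑-distrib-+ (λ v → ⟦ x ∼? v ⟧) (λ v → ⟦ y ∼? v ⟧) ⟩
      count (x ∼?_) + count (y ∼?_)  ≡⟨ cong₂ _+_ (count-∼ x) (count-∼ y) ⟩
      N + N                          ≡⟨ cong (N +_) (+-identityʳ N) ⟨
      2 * N                          ≡⟨ order ⟨
      n                              ≡⟨ *-identityʳ n ⟨
      n * 1                          ≡⟨ sum-const n 1 ⟨
      ∑[ v < n ] 1                   ∎

  -- If `w` lay in the class of `z` instead, `z a w z′ v z` would be a closed walk of length 5.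
  ∼-trans : ∀ {u v w} → u ∼ v → v ∼ w → u ∼ w
  ∼-trans (z , uz , zv) (z′ , vz′ , z′w) with sides-cover uz _
  ... | inj₁ u∼w           = u∼w
  ... | inj₂ (a , za , aw) = ⊥-elim (no-closed-5-walk za aw (adj-sym z′w) (adj-sym vz′) (adj-sym zv))

  ∼⇒¬adj : ∀ {u v} → u ∼ v → ¬ Adj u v
  ∼⇒¬adj (z , uz , zv) uv = no-3-cycle uz zv (adj-sym uv)

  short-walk : ∀ u v → ∃ λ l → l ≤ 3 × Walk G u v l
  short-walk u v with neighbour u
  ... | z , uz with sides-cover uz v
  ...   | inj₁ (a , ua , av) = 2 , m≤n+m 2 1 , ua ∷ av ∷ []
  ...   | inj₂ (a , za , av) = 3 , ≤-refl , uz ∷ za ∷ av ∷ []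

  -- Bounds on independent sets.

  module _ {I : Pred (Fin n) 0ℓ} (I? : Decidable I) (independent : ∀ {u v} → Adj u v → I u → I v → ⊥) where

    open ≤-Reasoning

    -- Sum the number of ends in `I` over ordered adjacent pairs. Each vertex of `I` contributes
    -- `suc q` times as first and `suc q` times as second end; each of the `suc q * n` pairs gives
    -- at most 1, and `(u₀ , v₀)` gives 0.
    independent-count : ∀ {u v} → Adj u v → ¬ I u → ¬ I v → count I? < N
    independent-count {u₀} {v₀} u₀v₀ ¬u₀ ¬v₀ = *-cancelˡ-< 2 _ _ (*-cancelˡ-< (suc q) _ _ (begin-strict
      suc q * (2 * count I?)
        ≡⟨ double (suc q) (count I?) ⟩
      suc q * count I? + suc q * count I?
        ≡⟨ cong₂ _+_ out-ends in-ends ⟨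
      ∑[ u < n ] ∑[ v < n ] (⟦ adj? u v ⟧ * ⟦ I? u ⟧) + ∑[ u < n ] ∑[ v < n ] (⟦ adj? u v ⟧ * ⟦ I? v ⟧)
        ≡⟨ ∑-distrib-+ (λ u → ∑[ v < n ] (⟦ adj? u v ⟧ * ⟦ I? u ⟧)) (λ u → ∑[ v < n ] (⟦ adj? u v ⟧ * ⟦ I? v ⟧)) ⟨
      ∑[ u < n ] (∑[ v < n ] (⟦ adj? u v ⟧ * ⟦ I? u ⟧) + ∑[ v < n ] (⟦ adj? u v ⟧ * ⟦ I? v ⟧))
        ≡⟨ sum-cong-≗ (λ u → ∑-distrib-+ (λ v → ⟦ adj? u v ⟧ * ⟦ I? u ⟧) (λ v → ⟦ adj? u v ⟧ * ⟦ I? v ⟧)) ⟨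
      ∑[ u < n ] ∑[ v < n ] ends u v
        <⟨ sum-mono-< (λ u → sum-mono (ends≤adj u)) u₀ (sum-mono-< (ends≤adj u₀) v₀ ends<adj) ⟩
      ∑[ u < n ] count (adj? u)
        ≡⟨ sum-cong-≗ count-adj ⟩
      ∑[ u < n ] suc q
        ≡⟨ sum-const n (suc q) ⟩
      n * suc q
        ≡⟨ *-comm n (suc q) ⟩
      suc q * n
        ≡⟨ cong (suc q *_) order ⟩
      suc q * (2 * N) ∎))
      where
      double : ∀ a b → a * (2 * b) ≡ a * b + a * b
      double = solve-∀

      ends : Fin n → Fin n → ℕ
      ends u v = ⟦ adj? u v ⟧ * ⟦ I? u ⟧ + ⟦ adj? u v ⟧ * ⟦ I? v ⟧

      ends≤adj : ∀ u v → ends u v ≤ ⟦ adj? u v ⟧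
      ends≤adj u v with adj? u v
      ... | no _   = z≤n
      ... | yes uv rewrite *-identityˡ ⟦ I? u ⟧ | *-identityˡ ⟦ I? v ⟧ = ⟦⟧-disjoint (independent uv) (I? u) (I? v)

      ends<adj : ends u₀ v₀ < ⟦ adj? u₀ v₀ ⟧
      ends<adj rewrite ⟦⟧-true (adj? u₀ v₀) u₀v₀ | ⟦⟧-false (I? u₀) ¬u₀ | ⟦⟧-false (I? v₀) ¬v₀ = ≤-refl

      out-ends : ∑[ u < n ] ∑[ v < n ] (⟦ adj? u v ⟧ * ⟦ I? u ⟧) ≡ suc q * count I?
      out-ends = begin-equality
        ∑[ u < n ] ∑[ v < n ] (⟦ adj? u v ⟧ * ⟦ I? u ⟧)
          ≡⟨ sum-cong-≗ (λ u → *-distribʳ-sum ⟦ I? u ⟧ (λ v → ⟦ adj? u v ⟧)) ⟨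
        ∑[ u < n ] (count (adj? u) * ⟦ I? u ⟧)
          ≡⟨ sum-cong-≗ (λ u → cong (_* ⟦ I? u ⟧) (count-adj u)) ⟩
        ∑[ u < n ] (suc q * ⟦ I? u ⟧)
          ≡⟨ *-distribˡ-sum (suc q) (λ u → ⟦ I? u ⟧) ⟨
        suc q * count I? ∎

      in-ends : ∑[ u < n ] ∑[ v < n ] (⟦ adj? u v ⟧ * ⟦ I? v ⟧) ≡ suc q * count I?
      in-ends = begin-equality
        ∑[ u < n ] ∑[ v < n ] (⟦ adj? u v ⟧ * ⟦ I? v ⟧)
          ≡⟨ ∑-comm (λ u v → ⟦ adj? u v ⟧ * ⟦ I? v ⟧) ⟩
        ∑[ v < n ] ∑[ u < n ] (⟦ adj? u v ⟧ * ⟦ I? v ⟧)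
          ≡⟨ sum-cong-≗ (λ v → *-distribʳ-sum ⟦ I? v ⟧ (λ u → ⟦ adj? u v ⟧)) ⟨
        ∑[ v < n ] (count (λ u → adj? u v) * ⟦ I? v ⟧)
          ≡⟨ sum-cong-≗ (λ v → cong (_* ⟦ I? v ⟧) (count-adjʳ v)) ⟩
        ∑[ v < n ] (suc q * ⟦ I? v ⟧)
          ≡⟨ *-distribˡ-sum (suc q) (λ v → ⟦ I? v ⟧) ⟨
        suc q * count I? ∎

    -- A path `p l′ p′ l` joins the two vertices, and its middle edge avoids `I`: `l′` is adjacent
    -- to `p` and `p′` to `l`.
    independent-across : ∀ {p l} → I p → I l → ¬ p ∼ l → count I? < N
    independent-across {p} {l} Ip Il p≁l with neighbour p
    ... | l′ , pl′ with sides-cover pl′ l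
    ...   | inj₁ p∼l              = ⊥-elim (p≁l p∼l)
    ...   | inj₂ (p′ , l′p′ , p′l) =
      independent-count l′p′ (independent pl′ Ip) (λ Ip′ → independent p′l Ip′ Il)

  -- Upper bound: a colouring with `suc N` colours.

  coloring : Fin n → PackingColoring G (suc N)
  coloring x = record
    { Γ       = λ v → color v (sides-cover xy v)
    ; Γ≥1     = λ v → color≥1 v (sides-cover xy v)
    ; Γ≤k     = λ v → color≤ v (sides-cover xy v)
    ; packing = λ i u v u≢v Γu Γv → packed i u v u≢v (sides-cover xy u) (sides-cover xy v) Γu Γv
    }
    where
    y : Fin n
    y = proj₁ (neighbour x)

    xy : Adj x y
    xy = proj₂ (neighbour x)

    lines : List (Fin n)
    lines = filter (y ∼?_) (allFin n)

    ∈-lines : ∀ {v} → y ∼ v → v ∈ lines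
    ∈-lines yv = ∈-filter⁺ (y ∼?_) (∈-allFin _) yv

    length-lines : length lines ≡ N
    length-lines = trans (length-filter-tabulate (y ∼?_) (λ v → v)) (count-∼ y)

    color : ∀ v → x ∼ v ⊎ y ∼ v → ℕ
    color v (inj₁ _)  = 1
    color v (inj₂ yv) = 2 + toℕ (index (∈-lines yv))

    color≥1 : ∀ v s → 1 ≤ color v s
    color≥1 v (inj₁ _) = ≤-refl
    color≥1 v (inj₂ _) = s≤s z≤n

    color≤ : ∀ v s → color v s ≤ suc N
    color≤ v (inj₁ _)  = s≤s z≤n
    -- Positions are below `N`, so the colour is at most `2 + (N ∸ 1)`, that is `suc N`.
    color≤ v (inj₂ yv) = s≤s (subst (toℕ (index (∈-lines yv)) <_) length-lines (toℕ<n _))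

    packed : ∀ i u v → u ≢ v → ∀ s t → color u s ≡ i → color v t ≡ i → DistanceAtLeast G u v (i + 1)
    -- Colour 1 demands distance 2: length 0 contradicts `u ≢ v`, and length 1 would be an edge
    -- inside one side.
    packed i u v u≢v (inj₁ xu) (inj₁ xv) refl _ 0 ([] , _) = ⊥-elim (u≢v refl)
    packed i u v u≢v (inj₁ xu) (inj₁ xv) refl _ 1 (uv ∷ [] , _) =
      ⊥-elim (∼⇒¬adj (∼-trans (∼-sym xu) xv) uv)
    packed i u v u≢v (inj₁ xu) (inj₁ xv) refl _ (suc (suc d)) _ = s≤s (s≤s z≤n)
    packed i u v u≢v (inj₁ _)  (inj₂ _)  refl ()
    packed i u v u≢v (inj₂ _)  (inj₁ _)  refl ()
    -- No distance has to be examined here: equal colours mean equal positions in `lines`, hence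
    -- equal vertices.
    packed i u v u≢v (inj₂ yu) (inj₂ yv) refl e = ⊥-elim (u≢v
      (index-injective (setoid _) (∈-lines yu) (∈-lines yv)
        (sym (toℕ-injective (suc-injective (suc-injective e))))))

  -- Lower bound: how often each colour can occur.

  module _ {k : ℕ} (Π : PackingColoring G k) (x : Fin n) where
    open PackingColoring Π

    ones? : Decidable (λ v → Γ v ≡ 1)
    ones? v = Γ v ≟ 1

    twos? : Decidable (λ v → Γ v ≡ 2)
    twos? v = Γ v ≟ 2

    -- The form in which packing is used: any walk will do, shortest or not.
    same-color-bound : ∀ {u v l} i → Γ u ≡ i → Γ v ≡ i → Walk G u v l → l ≤ i → u ≡ v
    same-color-bound {u} {v} {l} i Γu Γv w l≤i = decidable-stable (u ≟ᶠ v) λ u≢v →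
      <⇒≱ (≤-trans (≤-reflexive (+-comm 1 i)) (walk-length-bound G (packing i u v u≢v Γu Γv) l w)) l≤i

    ones-independent : ∀ {u v} → Adj u v → Γ u ≡ 1 → Γ v ≡ 1 → ⊥
    ones-independent uv Γu Γv = adj⇒≢ uv (same-color-bound 1 Γu Γv (uv ∷ []) ≤-refl)

    -- Vertices of one side are joined by a walk of length 2, too short for two vertices of colour
    -- 2.
    twos-side : ∀ y → count (λ v → twos? v ×-dec (y ∼? v)) ≤ 1
    twos-side y = count-subsingleton-≤1 (λ v → twos? v ×-dec (y ∼? v)) unique
      where
      unique : ∀ u v → Γ u ≡ 2 × y ∼ u → Γ v ≡ 2 × y ∼ v → u ≡ v
      unique u v (Γu , yu) (Γv , yv) with ∼-trans (∼-sym yu) yv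
      ... | z , uz , zv = same-color-bound 2 Γu Γv (uz ∷ zv ∷ []) ≤-refl

    -- Walks of length at most 3 join any two vertices, so a colour from 3 on cannot repeat.
    color-count : ∀ i → count (λ v → Γ v ≟ 3 + i) ≤ 1
    color-count i = count-subsingleton-≤1 (λ v → Γ v ≟ 3 + i) λ u v Γu Γv →
      let l , l≤3 , w = short-walk u v in same-color-bound (3 + i) Γu Γv w (≤-trans l≤3 (m≤m+n 3 i))

    twos-count : count twos? ≤ 2
    twos-count = begin
      count twos?
        ≤⟨ sum-mono split ⟩
      ∑[ v < n ] (⟦ twos? v ×-dec (x ∼? v) ⟧ + ⟦ twos? v ×-dec (y ∼? v) ⟧)
        ≡⟨ ∑-distrib-+ (λ v → ⟦ twos? v ×-dec (x ∼? v) ⟧) (λ v → ⟦ twos? v ×-dec (y ∼? v) ⟧) ⟩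
      count (λ v → twos? v ×-dec (x ∼? v)) + count (λ v → twos? v ×-dec (y ∼? v))
        ≤⟨ +-mono-≤ (twos-side x) (twos-side y) ⟩
      2 ∎
      where
      open ≤-Reasoning
      y = proj₁ (neighbour x)

      split : ∀ v → ⟦ twos? v ⟧ ≤ ⟦ twos? v ×-dec (x ∼? v) ⟧ + ⟦ twos? v ×-dec (y ∼? v) ⟧
      split v with sides-cover (proj₂ (neighbour x)) v
      ... | inj₁ xv rewrite ⟦⟧-× (twos? v) (x ∼? v) | ⟦⟧-true (x ∼? v) xv | *-identityʳ ⟦ twos? v ⟧ = m≤m+n _ _
      ... | inj₂ yv rewrite ⟦⟧-× (twos? v) (y ∼? v) | ⟦⟧-true (y ∼? v) yv | *-identityʳ ⟦ twos? v ⟧ = m≤n+m _ _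

    -- On the side of `p`, the `N` vertices pay for colours 1 and 2 together; on the side of `l`
    -- only colour 2 is left, at most once.
    one-sided-count : ∀ p → (∀ v → Γ v ≡ 1 → p ∼ v) → count ones? + count twos? ≤ suc N
    one-sided-count p ones⊆ = begin
      count ones? + count twos?
        ≡⟨ ∑-distrib-+ (λ v → ⟦ ones? v ⟧) (λ v → ⟦ twos? v ⟧) ⟨
      ∑[ v < n ] (⟦ ones? v ⟧ + ⟦ twos? v ⟧)
        ≤⟨ sum-mono split ⟩
      ∑[ v < n ] (⟦ twos? v ×-dec (l ∼? v) ⟧ + ⟦ p ∼? v ⟧)
        ≡⟨ ∑-distrib-+ (λ v → ⟦ twos? v ×-dec (l ∼? v) ⟧) (λ v → ⟦ p ∼? v ⟧) ⟩
      count (λ v → twos? v ×-dec (l ∼? v)) + count (p ∼?_)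
        ≤⟨ +-mono-≤ (twos-side l) (≤-reflexive (count-∼ p)) ⟩
      suc N ∎
      where
      open ≤-Reasoning
      l = proj₁ (neighbour p)
      pl = proj₂ (neighbour p)

      disjoint : ∀ v → Γ v ≡ 1 → Γ v ≡ 2 → ⊥
      disjoint v e e′ with trans (sym e) e′
      ... | ()

      split : ∀ v → ⟦ ones? v ⟧ + ⟦ twos? v ⟧ ≤ ⟦ twos? v ×-dec (l ∼? v) ⟧ + ⟦ p ∼? v ⟧
      split v with sides-cover pl v
      ... | inj₁ pv rewrite ⟦⟧-true (p ∼? v) pv = ≤-trans (⟦⟧-disjoint (disjoint v) (ones? v) (twos? v)) (m≤n+m 1 _)
      ... | inj₂ lv rewrite ⟦⟧-false (ones? v) (λ Γv → sides-disjoint pl (ones⊆ v Γv) lv)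
                          | ⟦⟧-× (twos? v) (l ∼? v) | ⟦⟧-true (l ∼? v) lv | *-identityʳ ⟦ twos? v ⟧ = m≤m+n _ _

    -- At most `N ∸ 1` vertices have colour 1, and one on each side has colour 2 at most.
    few-ones : count ones? < N → count ones? + count twos? ≤ suc N
    few-ones ones<N = begin
      count ones? + count twos?  ≤⟨ +-monoʳ-≤ (count ones?) twos-count ⟩
      count ones? + 2            ≡⟨ +-suc (count ones?) 1 ⟩
      suc (count ones? + 1)      ≡⟨ cong suc (+-comm (count ones?) 1) ⟩
      suc (suc (count ones?))    ≤⟨ s≤s ones<N ⟩
      suc N                      ∎
      where open ≤-Reasoning

    ones-twos-count : count ones? + count twos? ≤ suc N
    ones-twos-count with any? ones?
    ... | no none = few-ones (subst (_< N) (sym (count-empty ones? (λ v Γv → none (v , Γv)))) (s≤s z≤n))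
    -- A finite search decides whether colour 1 also meets the side opposite to `p`.
    ... | yes (p , Γp) with any? (λ l → ones? l ×-dec ¬? (p ∼? l))
    ...   | yes (l , Γl , p≁l) = few-ones (independent-across ones? ones-independent Γp Γl p≁l)
    ...   | no one-sided = one-sided-count p λ v Γv →
              decidable-stable (p ∼? v) λ p≁v → one-sided (v , Γv , p≁v)

    -- Each vertex is charged to its colour: 1 and 2 jointly, and the `k ∸ 2` colours from 3 on at
    -- most once each.
    n-bound : n ≤ suc N + (k ∸ 2)
    n-bound = begin
      n
        ≡⟨ trans (sum-const n 1) (*-identityʳ n) ⟨
      ∑[ v < n ] 1
        ≤⟨ sum-mono colored ⟩
      ∑[ v < n ] (⟦ ones? v ⟧ + ⟦ twos? v ⟧ + large v)
        ≡⟨ ∑-distrib-+ (λ v → ⟦ ones? v ⟧ + ⟦ twos? v ⟧) large ⟩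
      ∑[ v < n ] (⟦ ones? v ⟧ + ⟦ twos? v ⟧) + ∑[ v < n ] large v
        ≡⟨ cong₂ _+_ (∑-distrib-+ (λ v → ⟦ ones? v ⟧) (λ v → ⟦ twos? v ⟧))
                     (∑-comm (λ v (i : Fin (k ∸ 2)) → ⟦ Γ v ≟ 3 + toℕ i ⟧)) ⟩
      count ones? + count twos? + ∑[ i < k ∸ 2 ] count (λ v → Γ v ≟ 3 + toℕ i)
        ≤⟨ +-mono-≤ ones-twos-count (sum-mono (λ (i : Fin (k ∸ 2)) → color-count (toℕ i))) ⟩
      suc N + ∑[ i < k ∸ 2 ] 1
        ≡⟨ cong (suc N +_) (trans (sum-const (k ∸ 2) 1) (*-identityʳ (k ∸ 2))) ⟩
      suc N + (k ∸ 2) ∎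
      where
      open ≤-Reasoning
      large : Fin n → ℕ
      large v = ∑[ i < k ∸ 2 ] ⟦ Γ v ≟ 3 + toℕ i ⟧

      colored : ∀ v → 1 ≤ ⟦ ones? v ⟧ + ⟦ twos? v ⟧ + large v
      colored v with Γ v in eq
      ... | 0 = ⊥-elim (<⇒≱ (Γ≥1 v) (≤-reflexive eq))
      ... | 1 = s≤s z≤n
      ... | 2 = s≤s z≤n
      ... | suc (suc (suc j)) = ≤-trans
              (≤-reflexive (sym (⟦⟧-true (3 + j ≟ 3 + toℕ i) (cong (3 +_) (sym (toℕ-fromℕ< j<k-2))))))
              (term≤sum (λ i → ⟦ 3 + j ≟ 3 + toℕ i ⟧) i)
        where
        j<k-2 : j < k ∸ 2
        j<k-2 = ∸-monoˡ-≤ 2 (subst (_≤ k) eq (Γ≤k v))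
        i : Fin (k ∸ 2)
        i = fromℕ< j<k-2

    color-bound : 1 ≤ q → suc N ≤ k
    color-bound 1≤q = conclude k (+-cancelˡ-≤ N _ _ (begin
      N + N               ≡⟨ cong (N +_) (+-identityʳ N) ⟨
      2 * N               ≡⟨ order ⟨
      n                   ≤⟨ n-bound ⟩
      suc N + (k ∸ 2)     ≡⟨ +-suc N (k ∸ 2) ⟨
      N + suc (k ∸ 2)     ∎))
      where
      open ≤-Reasoning
      1<N : 1 < N
      1<N = s≤s (≤-trans 1≤q (m≤m+n q (q * q)))
      conclude : ∀ k → N ≤ suc (k ∸ 2) → suc N ≤ k
      -- For `k < 2` the truncated `k ∸ 2` is 0 and the inequality says `N ≤ 1`, against `1 < N`,
      -- which comes from `1 ≤ q`.
      conclude 0             N≤ = ⊥-elim (<⇒≱ 1<N N≤)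
      conclude 1             N≤ = ⊥-elim (<⇒≱ 1<N N≤)
      conclude (suc (suc k)) N≤ = s≤s N≤

theorem3p1 : ∀ (q : ℕ) → 1 ≤ q → ∀ {n : ℕ} (G : Graph n) →
    IsMooreGraph (q + 1) 6 G →
    IsPackingChromaticNumber G (q ^ 2 + q + 2)
theorem3p1 q 1≤q {n} G moore =
  subst (IsPackingChromaticNumber G) (sym (χ≡ q)) (coloring x , λ k Π → color-bound Π x 1≤q)
  where
  open IsMooreGraph moore

  order′ : n ≡ 2 * suc (q + q * q)
  -- As `6 / 2` is 3, `n₀ (q + 1) 6` is twice a sum of three powers of `(q + 1) ∸ 1`.
  order′ = trans order (trans (cong (λ m → 2 * (m ^ 0 + (m ^ 1 + (m ^ 2 + 0)))) (m+n∸n≡m q 1)) (geometric q))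
    where
    geometric : ∀ m → 2 * (1 + (m * 1 + (m * (m * 1) + 0))) ≡ 2 * suc (m + m * m)
    geometric = solve-∀

  open Moore G q (proj₂ girth) (λ v → trans (regular v) (+-comm q 1)) order′

  x : Fin n
  -- The order is a successor, which supplies a vertex from which to fix the sides.
  x = subst Fin (sym order′) zero

  χ≡ : ∀ m → m * (m * 1) + m + 2 ≡ suc (suc (m + m * m))
  χ≡ = solve-∀
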